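{- Let $l$ and $m$ be positive integers and let $q(x)=x^6-(l+m+3)x^4+(lm+l+m+3)x^2-1$. Suppose $\pm\theta_1,\pm\theta_2,\pm\theta_3$ are the six roots of $q(x)$ in its splitting field over $\mathbb{Q}$. If $q(x)$ is irreducible over $\mathbb{Q}$, then $1,\theta_1,\theta_2,\theta_3$ are linearly independent over $\mathbb{Q}$.
   Context: The roots of $q$ are simple, nonzero and real, and come in pairs $\pm\theta_j$; the labeling means the six roots are $\theta_1,-\theta_1,\theta_2,-\theta_2,\theta_3,-\theta_3$. -}

module Defs where

open import Algebra.Apartness.Bundles using (HeytingField)
open import Algebra.Bundles using (CommutativeRing)
open import Algebra.Bundles.Raw using (RawRing; RawSemiring)
import Algebra.Definitions.RawSemiring as SemiringDefs
open import Algebra.Morphism.Structures using (module RingMorphisms)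
import Algebra.Properties.CommutativeMonoid.Sum as Sum
open import Data.Fin.Base using (Fin)
open import Data.Integer.Base using (+_)
open import Data.List.Base using (List; []; _∷_; map; foldr)
open import Data.List.Membership.Propositional using (_∈_)
open import Data.Nat.Base as ℕ using (ℕ; zero; suc)
open import Data.Product.Base using (∃-syntax; _×_)
open import Data.Rational.Base as ℚ using (ℚ; 0ℚ; 1ℚ)
open import Data.Rational.Literals using (fromℤ)
open import Data.Vec.Functional using (Vector)
open import Level using (Level; _⊔_) renaming (suc to lsuc)
open import Relation.Binary.PropositionalEquality.Core using (_≡_)

-- A polynomial is its list of coefficients, constant term first.  Trailing
-- zeros are allowed; _≈ₚ_ ignores them.
module Polynomial {c ℓ : Level} (R : RawRing c ℓ) where
  open RawRing R hiding (rawSemiring)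

  Poly : Set c
  Poly = List Carrier

  coeff : Poly → ℕ → Carrier
  coeff []      _       = 0#
  coeff (a ∷ p) zero    = a
  coeff (a ∷ p) (suc n) = coeff p n

  infix  4 _≈ₚ_
  infixl 6 _+ₚ_
  infixl 7 _*ₚ_

  _≈ₚ_ : Poly → Poly → Set ℓ
  p ≈ₚ q = ∀ n → coeff p n ≈ coeff q n

  _+ₚ_ : Poly → Poly → Poly
  []      +ₚ q       = q
  (a ∷ p) +ₚ []      = a ∷ p
  (a ∷ p) +ₚ (b ∷ q) = (a + b) ∷ (p +ₚ q)

  _*ₚ_ : Poly → Poly → Poly
  []      *ₚ q = []
  (a ∷ p) *ₚ q = map (a *_) q +ₚ (0# ∷ (p *ₚ q))

  const : Carrier → Poly
  const a = a ∷ []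

  X-_ : Carrier → Poly
  X- r = (- r) ∷ 1# ∷ []

  ∏[X-_] : List Carrier → Poly
  ∏[X- rs ] = foldr (λ r p → (X- r) *ₚ p) (const 1#) rs

  rawSemiring : RawSemiring c ℓ
  rawSemiring = record
    { Carrier = Poly
    ; _≈_     = _≈ₚ_
    ; _+_     = _+ₚ_
    ; _*_     = _*ₚ_
    ; 0#      = []
    ; 1#      = const 1#
    }

module ℚ[X] = Polynomial ℚ.+-*-rawRing

IrreducibleOverℚ : ℚ[X].Poly → Set
IrreducibleOverℚ = SemiringDefs.Irreducible ℚ[X].rawSemiring

record ExtensionOfℚ (c ℓ₁ ℓ₂ : Level) : Set (lsuc (c ⊔ ℓ₁ ⊔ ℓ₂)) where
  field
    field′ : HeytingField c ℓ₁ ℓ₂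

  open HeytingField field′ public

  commutativeRing : CommutativeRing c ℓ₁
  commutativeRing = record { isCommutativeRing = isCommutativeRing }

  open CommutativeRing commutativeRing public
    using (rawRing; +-commutativeMonoid)

  field
    ι              : ℚ → Carrier
    ι-homomorphism : RingMorphisms.IsRingHomomorphism ℚ.+-*-rawRing rawRing ι

module _ {c ℓ₁ ℓ₂ : Level} (K : ExtensionOfℚ c ℓ₁ ℓ₂) where
  open ExtensionOfℚ K
  open Polynomial rawRing
  open Sum +-commutativeMonoid using (sum)

  -- rs lists all the roots of f, with multiplicity, and f splits over K.
  HasRoots : ℚ[X].Poly → List Carrier → Set (c ⊔ ℓ₁ ⊔ ℓ₂)
  HasRoots f rs = ∃[ a ] (a # 0#) × (map ι f ≈ₚ const a *ₚ ∏[X- rs ])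

  -- The smallest subfield ℚ(rs) of K containing ℚ and rs.
  data Adjoin (rs : List Carrier) : Carrier → Set (c ⊔ ℓ₁) where
    rational  : ∀ a → Adjoin rs (ι a)
    generator : ∀ {x} → x ∈ rs → Adjoin rs x
    sums      : ∀ {x y} → Adjoin rs x → Adjoin rs y → Adjoin rs (x + y)
    products  : ∀ {x y} → Adjoin rs x → Adjoin rs y → Adjoin rs (x * y)
    negatives : ∀ {x} → Adjoin rs x → Adjoin rs (- x)
    inverses  : ∀ {x y} → Adjoin rs x → x * y ≈ 1# → Adjoin rs y
    respects  : ∀ {x y} → x ≈ y → Adjoin rs x → Adjoin rs y

  IsSplittingField : ℚ[X].Poly → Set (c ⊔ ℓ₁ ⊔ ℓ₂)
  IsSplittingField f = ∃[ rs ] HasRoots f rs × (∀ x → Adjoin rs x)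

  LinearlyIndependentOverℚ : ∀ {n} → Vector Carrier n → Set ℓ₁
  LinearlyIndependentOverℚ {n} v =
    (a : Vector ℚ n) → sum (λ i → ι (a i) * v i) ≈ 0# → (i : Fin n) → a i ≡ 0ℚ

fromℕ : ℕ → ℚ
fromℕ n = fromℤ (+ n)

-- x⁶ − (l+m+3)x⁴ + (lm+l+m+3)x² − 1
q : ℕ → ℕ → ℚ[X].Poly
q l m = (ℚ.- 1ℚ)
      ∷ 0ℚ
      ∷ fromℕ (l ℕ.* m ℕ.+ l ℕ.+ m ℕ.+ 3)
      ∷ 0ℚ
      ∷ (ℚ.- fromℕ (l ℕ.+ m ℕ.+ 3))
      ∷ 0ℚ
      ∷ 1ℚ
      ∷ []

{-# OPTIONS --safe #-}
module Submission where

-- Write t, u, v for θ₁, θ₂, θ₃ and A for l + m + 3.  Comparing coefficients,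
-- t² + u² + v² = A and tuv = e with e = ±1.  Given x + y t + z u + w v = 0,
-- squaring z u + w v = −(x + y t) and multiplying by t gives
-- t (z² u² + w² v²) = t (x + y t)² − 2 e z w.  Together with
-- u² + v² = A − t² this makes t (z² − w²) u² a cubic in t over ℚ, and likewise
-- t (w² − z²) v².  Their product is −(z² − w²)², so the product of the two
-- cubics plus (z² − w²)² is a sextic vanishing at t, hence a multiple of q.
-- As q has leading coefficient 1 and constant term −1, the constant and
-- leading coefficients of this sextic, (z² + w²)² and (y² + w²)(y² + z²), are
-- opposite.  Both are nonnegative, hence z = w = 0, and then x + y t = 0 gives
-- x = y = 0.

open import Defs
import Algebra.Apartness.Properties.HeytingCommutativeRing as HeytingProperties
open import Algebra.Bundles.Raw using (RawRing; module RawSemiring)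
open import Algebra.Definitions.RawMagma (RawSemiring.*-rawMagma ℚ[X].rawSemiring) using (_∣_; _,_)
import Algebra.Definitions.RawSemiring as SemiringDefs
open import Algebra.Morphism.Structures using (module RingMorphisms)
import Algebra.Solver.Ring as RingSolver
import Algebra.Solver.Ring.AlmostCommutativeRing as ACR
open import Data.Fin.Patterns using (0F; 1F; 2F; 3F)
open import Data.Integer.Base as ℤ using (-[1+_])
open import Data.List.Base using (List; []; _∷_; map)
import Data.Maybe.Base as Maybe
open import Data.Nat.Base as ℕ using (ℕ; zero; suc; z≤n; s≤s; NonZero)
import Data.Nat.Properties as ℕ
open import Data.Product.Base using (∃-syntax; _×_; _,_; proj₁; proj₂)
open import Data.Rational.Base as ℚ using (ℚ; 0ℚ; 1ℚ; ½; mkℚ)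
open import Data.Rational.Properties as ℚ using (_≟_)
open import Data.Rational.Solver using (module +-*-Solver)
open import Data.Sum.Base using (_⊎_; inj₁; inj₂)
import Data.Vec.Functional as Vector
open import Level using (Level)
open import Relation.Binary.PropositionalEquality as ≡ using (_≡_; _≢_)
import Relation.Binary.Reasoning.Setoid as ≈-Reasoning
open import Relation.Nullary using (¬_; yes; no; contradiction)
open import Relation.Nullary.Decidable.Core using (dec⇒maybe)

-- Degrees, units and division with remainder for polynomials over ℚ.

module RationalPolynomials where
  open ℚ[X]
  open import Data.Rational.Base using (_+_; _*_; -_; 1/_)
  open ≡ using (refl; sym; trans; cong; cong₂)
  open +-*-Solver using (solve; _:=_; _:+_; _:*_; :-_)
  open ≡.≡-Reasoning

  coeff-+ : ∀ p r n → coeff (p +ₚ r) n ≡ coeff p n + coeff r n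
  coeff-+ []      r       n       = sym (ℚ.+-identityˡ _)
  coeff-+ (a ∷ p) []      n       = sym (ℚ.+-identityʳ _)
  coeff-+ (a ∷ p) (b ∷ r) zero    = refl
  coeff-+ (a ∷ p) (b ∷ r) (suc n) = coeff-+ p r n

  coeff-scale : ∀ a p n → coeff (map (a *_) p) n ≡ a * coeff p n
  coeff-scale a []      n       = sym (ℚ.*-zeroʳ a)
  coeff-scale a (b ∷ p) zero    = refl
  coeff-scale a (b ∷ p) (suc n) = coeff-scale a p n

  coeff-∷* : ∀ a p r n → coeff ((a ∷ p) *ₚ r) n ≡ a * coeff r n + coeff (0ℚ ∷ p *ₚ r) n
  coeff-∷* a p r n =
    trans (coeff-+ (map (a *_) r) _ n) (cong (_+ coeff (0ℚ ∷ p *ₚ r) n) (coeff-scale a r n))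

  DegreeBelow : ℕ → Poly → Set
  DegreeBelow d p = ∀ n → d ℕ.≤ n → coeff p n ≡ 0ℚ

  -- Trailing zeros make the length of the list useless as a degree, so the degree is a relation,
  -- and a list of zeros has none.
  record HasDegree (p : Poly) (d : ℕ) : Set where
    field
      leading≢0 : coeff p d ≢ 0ℚ
      above≡0   : DegreeBelow (suc d) p

  open HasDegree public

  -- Works from the tail outwards: the head matters only when the tail vanishes, and then decidable
  -- equality on ℚ settles the case.
  degree : ∀ p → p ≈ₚ [] ⊎ ∃[ d ] HasDegree p d
  degree [] = inj₁ λ _ → refl
  degree (a ∷ p) with degree p
  ... | inj₂ (d , p-deg) = inj₂ (suc d , record
    { leading≢0 = leading≢0 p-deg
    ; above≡0   = λ { (suc n) (s≤s d<n) → above≡0 p-deg n d<n } })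
  ... | inj₁ p≈0 with a ≟ 0ℚ
  ...   | yes a≡0 = inj₁ λ { zero → a≡0 ; (suc n) → p≈0 n }
  ...   | no  a≢0 = inj₂ (0 , record
    { leading≢0 = a≢0
    ; above≡0   = λ { (suc n) _ → p≈0 n } })

  *-zeroˡ-≈ₚ : ∀ p r → p ≈ₚ [] → p *ₚ r ≈ₚ []
  *-zeroˡ-≈ₚ []      r p≈0 n = refl
  *-zeroˡ-≈ₚ (a ∷ p) r p≈0 n = begin
    coeff ((a ∷ p) *ₚ r) n                   ≡⟨ coeff-∷* a p r n ⟩
    a * coeff r n + coeff (0ℚ ∷ p *ₚ r) n    ≡⟨ cong₂ _+_ (cong (_* coeff r n) (p≈0 0)) (tail n) ⟩
    0ℚ * coeff r n + 0ℚ                      ≡⟨ trans (ℚ.+-identityʳ _) (ℚ.*-zeroˡ (coeff r n)) ⟩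
    0ℚ                                       ∎
    where
    tail : ∀ n → coeff (0ℚ ∷ p *ₚ r) n ≡ 0ℚ
    tail zero    = refl
    tail (suc n) = *-zeroˡ-≈ₚ p r (λ k → p≈0 (suc k)) n

  *-constant-degree : ∀ p r {d} → DegreeBelow 1 p → DegreeBelow d r → DegreeBelow d (p *ₚ r)
  *-constant-degree []      r p-const r-deg n d≤n = refl
  *-constant-degree (a ∷ p) r p-const r-deg n d≤n = begin
    coeff ((a ∷ p) *ₚ r) n                   ≡⟨ coeff-∷* a p r n ⟩
    a * coeff r n + coeff (0ℚ ∷ p *ₚ r) n    ≡⟨ cong₂ _+_ (cong (a *_) (r-deg n d≤n)) (tail n) ⟩
    a * 0ℚ + 0ℚ                              ≡⟨ trans (ℚ.+-identityʳ _) (ℚ.*-zeroʳ a) ⟩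
    0ℚ                                       ∎
    where
    tail : ∀ n → coeff (0ℚ ∷ p *ₚ r) n ≡ 0ℚ
    tail zero    = refl
    tail (suc n) = *-zeroˡ-≈ₚ p r (λ k → p-const (suc k) (s≤s z≤n)) n

  x*y≡0⇒x≡0 : ∀ x y → y ≢ 0ℚ → x * y ≡ 0ℚ → x ≡ 0ℚ
  x*y≡0⇒x≡0 x y y≢0 xy≡0 = begin
    x                ≡⟨ ℚ.*-identityʳ x ⟨
    x * 1ℚ           ≡⟨ cong (x *_) (ℚ.*-inverseʳ y) ⟨
    x * (y * 1/ y)   ≡⟨ ℚ.*-assoc x y (1/ y) ⟨
    x * y * 1/ y     ≡⟨ cong (_* 1/ y) xy≡0 ⟩
    0ℚ * 1/ y        ≡⟨ ℚ.*-zeroˡ (1/ y) ⟩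
    0ℚ               ∎
    where instance _ = ℚ.≢-nonZero y≢0

  -- Above degree `d` the head of `p` contributes nothing to the product, so the tail satisfies the
  -- same hypothesis and vanishes by induction. The coefficient at `d` is then the head times the
  -- nonzero leading coefficient of `r`.
  *-degree⇒≈0 : ∀ p {r d} → HasDegree r d → DegreeBelow d (p *ₚ r) → p ≈ₚ []
  *-degree⇒≈0 []      r-deg pr-deg n = refl
  *-degree⇒≈0 (a ∷ p) {r} {d} r-deg pr-deg = λ { zero → a≡0 ; (suc n) → p≈0 n }
    where
    p≈0 : p ≈ₚ []
    p≈0 = *-degree⇒≈0 p r-deg λ n d≤n → begin
      coeff (p *ₚ r) n                                ≡⟨ ℚ.+-identityˡ _ ⟨
      0ℚ + coeff (p *ₚ r) n                           ≡⟨ cong (_+ coeff (p *ₚ r) n) (ℚ.*-zeroʳ a) ⟨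
      a * 0ℚ + coeff (p *ₚ r) n                       ≡⟨ cong (λ x → a * x + coeff (p *ₚ r) n) (above≡0 r-deg (suc n) (s≤s d≤n)) ⟨
      a * coeff r (suc n) + coeff (p *ₚ r) n          ≡⟨ coeff-∷* a p r (suc n) ⟨
      coeff ((a ∷ p) *ₚ r) (suc n)                    ≡⟨ pr-deg (suc n) (ℕ.m≤n⇒m≤1+n d≤n) ⟩
      0ℚ                                              ∎
    tail : ∀ n → coeff (0ℚ ∷ p *ₚ r) n ≡ 0ℚ
    tail zero    = refl
    tail (suc n) = *-zeroˡ-≈ₚ p r p≈0 n
    a≡0 : a ≡ 0ℚ
    a≡0 = x*y≡0⇒x≡0 a (coeff r d) (leading≢0 r-deg) (begin
      a * coeff r d                            ≡⟨ ℚ.+-identityʳ _ ⟨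
      a * coeff r d + 0ℚ                       ≡⟨ cong ((a * coeff r d) +_) (tail d) ⟨
      a * coeff r d + coeff (0ℚ ∷ p *ₚ r) d    ≡⟨ coeff-∷* a p r d ⟨
      coeff ((a ∷ p) *ₚ r) d                   ≡⟨ pr-deg d ℕ.≤-refl ⟩
      0ℚ                                       ∎)

  -- If `p` had positive degree, the product `w *ₚ p` would have degree below that of `p`. This
  -- forces `w` to vanish, and then 0 = 1.
  ∣1⇒constant : ∀ p → p ∣ const 1ℚ → DegreeBelow 1 p
  ∣1⇒constant p (w , wp≈1) with degree p
  ... | inj₁ p≈0 = λ n _ → p≈0 n
  ... | inj₂ (zero  , p-deg) = above≡0 p-deg
  ... | inj₂ (suc d , p-deg) = contradiction 0≡1 λ ()
    where
    w≈0 : w ≈ₚ []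
    w≈0 = *-degree⇒≈0 w p-deg λ { (suc n) _ → wp≈1 (suc n) }
    0≡1 : 0ℚ ≡ 1ℚ
    0≡1 = trans (sym (*-zeroˡ-≈ₚ w p w≈0 0)) (wp≈1 0)

  -- Long division by recursion on the coefficients: the tail of `f` is divided first, then its
  -- remainder is shifted by one and reduced once more.
  divide : ∀ f {g d} → HasDegree g d → ∃[ s ] ∃[ r ] f ≈ₚ s *ₚ g +ₚ r × DegreeBelow d r
  divide []      g-deg = [] , [] , (λ _ → refl) , λ _ _ → refl
  divide (a ∷ f) {g} {d} g-deg with divide f g-deg
  ... | s , r , f≈sg+r , r-deg = c ∷ s , r′ , eq , r′-deg
    where
    instance _ = ℚ.≢-nonZero (leading≢0 g-deg)
    -- As `r` has degree below `d`, the shifted remainder `a ∷ r` has degree at most `d`. This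
    -- multiple of `g` has the same coefficient at `d`, so subtracting it lowers the degree.
    c = coeff (a ∷ r) d * 1/ coeff g d
    r′ = (a ∷ r) +ₚ map ((- c) *_) g

    coeff-r′ : ∀ n → coeff r′ n ≡ coeff (a ∷ r) n + (- c) * coeff g n
    coeff-r′ n = trans (coeff-+ (a ∷ r) (map ((- c) *_) g) n) (cong (coeff (a ∷ r) n +_) (coeff-scale (- c) g n))

    shift : ∀ n → coeff (a ∷ f) n ≡ coeff (0ℚ ∷ s *ₚ g) n + coeff (a ∷ r) n
    shift zero    = sym (ℚ.+-identityˡ a)
    shift (suc n) = trans (f≈sg+r n) (coeff-+ (s *ₚ g) r n)

    eq : a ∷ f ≈ₚ (c ∷ s) *ₚ g +ₚ r′
    eq n = begin
      coeff (a ∷ f) n                              ≡⟨ shift n ⟩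
      x + y                                        ≡⟨ solve 4 (λ x y c z → x :+ y := (c :* z :+ x) :+ (y :+ (:- c) :* z)) refl x y c z ⟩
      (c * z + x) + (y + (- c) * z)                ≡⟨ cong₂ _+_ (coeff-∷* c s g n) (coeff-r′ n) ⟨
      coeff ((c ∷ s) *ₚ g) n + coeff r′ n          ≡⟨ coeff-+ ((c ∷ s) *ₚ g) r′ n ⟨
      coeff ((c ∷ s) *ₚ g +ₚ r′) n                 ∎
      where
      x = coeff (0ℚ ∷ s *ₚ g) n
      y = coeff (a ∷ r) n
      z = coeff g n

    r′-deg : DegreeBelow d r′
    r′-deg n d≤n with ℕ.m≤n⇒m<n∨m≡n d≤n
    r′-deg (suc n) d≤n | inj₁ (s≤s d<n) = begin
      coeff r′ (suc n)                        ≡⟨ coeff-r′ (suc n) ⟩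
      coeff r n + (- c) * coeff g (suc n)     ≡⟨ cong₂ (λ x y → x + (- c) * y) (r-deg n d<n) (above≡0 g-deg (suc n) (s≤s d<n)) ⟩
      0ℚ + (- c) * 0ℚ                         ≡⟨ trans (ℚ.+-identityˡ _) (ℚ.*-zeroʳ (- c)) ⟩
      0ℚ                                      ∎
    r′-deg n d≤n | inj₂ refl = begin
      coeff r′ n                              ≡⟨ coeff-r′ n ⟩
      y + (- (y * i)) * z                     ≡⟨ solve 3 (λ y i z → y :+ (:- (y :* i)) :* z := y :+ (:- (y :* (i :* z)))) refl y i z ⟩
      y + (- (y * (i * z)))                   ≡⟨ cong (λ x → y + (- (y * x))) (ℚ.*-inverseˡ z) ⟩
      y + (- (y * 1ℚ))                        ≡⟨ cong (λ x → y + (- x)) (ℚ.*-identityʳ y) ⟩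
      y + (- y)                               ≡⟨ ℚ.+-inverseʳ y ⟩
      0ℚ                                      ∎
      where
      y = coeff (a ∷ r) n
      z = coeff g n
      i = 1/ z

open RationalPolynomials

-- Sums of squares in ℚ.

0≤x*x : ∀ x → 0ℚ ℚ.≤ x ℚ.* x
0≤x*x x with ℚ.≤-total 0ℚ x
... | inj₁ 0≤x = ℚ.nonNegative⁻¹ (x ℚ.* x) {{ℚ.nonNeg*nonNeg⇒nonNeg x x}}
  where instance _ = ℚ.nonNegative 0≤x
... | inj₂ x≤0 = ℚ.nonNegative⁻¹ (x ℚ.* x) {{ℚ.nonPos*nonPos⇒nonPos x x}}
  where instance _ = ℚ.nonPositive x≤0

0≤x+y : ∀ {x y} → 0ℚ ℚ.≤ x → 0ℚ ℚ.≤ y → 0ℚ ℚ.≤ x ℚ.+ y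
0≤x+y 0≤x 0≤y = ℚ.+-mono-≤ 0≤x 0≤y

0≤x*y : ∀ {x y} → 0ℚ ℚ.≤ x → 0ℚ ℚ.≤ y → 0ℚ ℚ.≤ x ℚ.* y
0≤x*y {x} {y} 0≤x 0≤y = ℚ.nonNegative⁻¹ (x ℚ.* y) {{ℚ.nonNeg*nonNeg⇒nonNeg x y}}
  where instance
    _ = ℚ.nonNegative 0≤x
    _ = ℚ.nonNegative 0≤y

x+y≡0⇒x≡0 : ∀ {x y} → 0ℚ ℚ.≤ x → 0ℚ ℚ.≤ y → x ℚ.+ y ≡ 0ℚ → x ≡ 0ℚ
x+y≡0⇒x≡0 {x} {y} 0≤x 0≤y x+y≡0 = ℚ.≤-antisym
  (ℚ.≤-trans (ℚ.≤-reflexive (≡.sym (ℚ.+-identityʳ x)))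
    (ℚ.≤-trans (ℚ.+-monoʳ-≤ x 0≤y) (ℚ.≤-reflexive x+y≡0))) 0≤x

x*x≡0⇒x≡0 : ∀ x → x ℚ.* x ≡ 0ℚ → x ≡ 0ℚ
x*x≡0⇒x≡0 x xx≡0 with x ≟ 0ℚ
... | yes x≡0 = x≡0
... | no  x≢0 = x*y≡0⇒x≡0 x x x≢0 xx≡0

-- Both summands are nonnegative, so the square of x² + y² vanishes, hence x² + y² and with it each
-- of the two squares.
norm-positive-definite : ∀ x y z →
  (x ℚ.* x ℚ.+ y ℚ.* y) ℚ.* (x ℚ.* x ℚ.+ y ℚ.* y) ℚ.+
  (z ℚ.* z ℚ.+ y ℚ.* y) ℚ.* (z ℚ.* z ℚ.+ x ℚ.* x) ≡ 0ℚ → x ≡ 0ℚ × y ≡ 0ℚ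
norm-positive-definite x y z norm≡0 =
  x*x≡0⇒x≡0 x (x+y≡0⇒x≡0 (0≤x*x x) (0≤x*x y) xx+yy≡0) ,
  x*x≡0⇒x≡0 y (x+y≡0⇒x≡0 (0≤x*x y) (0≤x*x x) (≡.trans (ℚ.+-comm (y ℚ.* y) (x ℚ.* x)) xx+yy≡0))
  where
  xx+yy≡0 : x ℚ.* x ℚ.+ y ℚ.* y ≡ 0ℚ
  xx+yy≡0 = x*x≡0⇒x≡0 (x ℚ.* x ℚ.+ y ℚ.* y) (x+y≡0⇒x≡0 (0≤x*x (x ℚ.* x ℚ.+ y ℚ.* y))
    (0≤x*y (0≤x+y (0≤x*x z) (0≤x*x y)) (0≤x+y (0≤x*x z) (0≤x*x x))) norm≡0)

q-degree : ∀ l m → HasDegree (q l m) 6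
q-degree l m = record
  { leading≢0 = λ ()
  ; above≡0   = λ { _ (s≤s (s≤s (s≤s (s≤s (s≤s (s≤s (s≤s z≤n))))))) → ≡.refl }
  }

-- Computation in an extension of ℚ, and its square roots of 1.

module ExtensionProperties {c ℓ₁ ℓ₂ : Level} (K : ExtensionOfℚ c ℓ₁ ℓ₂) where
  open ExtensionOfℚ K public hiding (zero)
  open RingMorphisms.IsRingHomomorphism ι-homomorphism public
    using () renaming (⟦⟧-cong to ι-cong; +-homo to ι-+; *-homo to ι-*; -‿homo to ι-neg; 0#-homo to ι-0; 1#-homo to ι-1)
  open ≈-Reasoning setoid

  -- Agrees with ι, but sends 0 and 1 to 0# and 1# definitionally, so that the
  -- solver constants 0ℚ and 1ℚ denote exactly the 0# and 1# of Defs.Polynomial.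
  ι′ : ℚ → Carrier
  ι′ (mkℚ (ℤ.+ 0) 0 _) = 0#
  ι′ (mkℚ (ℤ.+ 1) 0 _) = 1#
  ι′ x                 = ι x

  ι′≈ι : ∀ x → ι′ x ≈ ι x
  ι′≈ι (mkℚ (ℤ.+ 0) 0 _)             = sym ι-0
  ι′≈ι (mkℚ (ℤ.+ 1) 0 _)             = sym ι-1
  ι′≈ι (mkℚ (ℤ.+ 0) (suc _) _)       = refl
  ι′≈ι (mkℚ (ℤ.+ 1) (suc _) _)       = refl
  ι′≈ι (mkℚ (ℤ.+ (suc (suc _))) _ _) = refl
  ι′≈ι (mkℚ -[1+ _ ] _ _)            = refl

  private
    ι′-morphism : ℚ.+-*-rawRing ACR.-Raw-AlmostCommutative⟶ ACR.fromCommutativeRing commutativeRing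
    ι′-morphism = record
      { ⟦_⟧    = ι′
      ; +-homo = λ x y → trans (ι′≈ι (x ℚ.+ y)) (trans (ι-+ x y) (sym (+-cong (ι′≈ι x) (ι′≈ι y))))
      ; *-homo = λ x y → trans (ι′≈ι (x ℚ.* y)) (trans (ι-* x y) (sym (*-cong (ι′≈ι x) (ι′≈ι y))))
      ; -‿homo = λ x → trans (ι′≈ι (ℚ.- x)) (trans (ι-neg x) (sym (-‿cong (ι′≈ι x))))
      ; 0-homo = refl
      ; 1-homo = refl
      }

  module Solver = RingSolver ℚ.+-*-rawRing (ACR.fromCommutativeRing commutativeRing) ι′-morphism
    (λ x y → Maybe.map (λ x≡y → reflexive (≡.cong ι′ x≡y)) (dec⇒maybe (x ≟ y)))

  -- The polynomial operations on solver expressions denote, definitionally,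
  -- the same operations on elements of K.
  exprRing : ℕ → RawRing _ _
  exprRing n = record
    { Carrier = Solver.Polynomial n
    ; _≈_     = _≡_
    ; _+_     = Solver._:+_
    ; _*_     = Solver._:*_
    ; -_      = Solver.:-_
    ; 0#      = Solver.con 0ℚ
    ; 1#      = Solver.con 1ℚ
    }

  1≉0 : ¬ 1# ≈ 0#
  1≉0 1≈0 = #-irrefl 1≈0 (HeytingProperties.1#0 (record { isHeytingCommutativeRing = isHeytingCommutativeRing }))

  -- Equality in `K` is not assumed decidable. Instead 1 and -1 are apart, their difference 2 having
  -- inverse ½, so by cotransitivity `x` is apart from one of them. The sign is returned as a
  -- rational because it enters the coefficients of `resolvent`.
  square≈1⇒±1 : ∀ {x} → x * x ≈ 1# → ∃[ e ] e ℚ.* e ≡ 1ℚ × x ≈ ι e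
  square≈1⇒±1 {x} xx≈1 with #-cotrans 1#-1 x
    where
    open Solver
    1#-1 : 1# # - 1#
    1#-1 = invertible⇒# (ι ½
      , solve 0 (con ½ :* (con 1ℚ :- (:- con 1ℚ)) := con 1ℚ) refl
      , solve 0 ((con 1ℚ :- (:- con 1ℚ)) :* con ½ := con 1ℚ) refl)
  -- With 1 - x invertible, x + 1 = w (1 - x²) = 0; the other case is symmetric.
  ... | inj₁ 1#x = let w , w[1-x]≈1 , _ = #⇒invertible 1#x in ℚ.- 1ℚ , ≡.refl , (begin
    x                                               ≈⟨ solve 1 (λ x → x := (x :+ con 1ℚ) :* con 1ℚ :- con 1ℚ) refl x ⟩
    (x + 1#) * 1# + - 1#                            ≈⟨ +-congʳ (*-congˡ w[1-x]≈1) ⟨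
    (x + 1#) * (w * (1# + - x)) + - 1#              ≈⟨ solve 2 (λ x w → (x :+ con 1ℚ) :* (w :* (con 1ℚ :- x)) :- con 1ℚ := w :* (con 1ℚ :- x :* x) :- con 1ℚ) refl x w ⟩
    w * (1# + - (x * x)) + - 1#                     ≈⟨ +-congʳ (*-congˡ (+-congˡ (-‿cong xx≈1))) ⟩
    w * (1# + - 1#) + - 1#                          ≈⟨ solve 1 (λ w → w :* (con 1ℚ :- con 1ℚ) :- con 1ℚ := con (ℚ.- 1ℚ)) refl w ⟩
    ι (ℚ.- 1ℚ)                                      ∎)
    where open Solver
  ... | inj₂ x#-1 = let w , w[x+1]≈1 , _ = #⇒invertible x#-1 in 1ℚ , ≡.refl , (begin
    x                                               ≈⟨ solve 1 (λ x → x := (x :- con 1ℚ) :* con 1ℚ :+ con 1ℚ) refl x ⟩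
    (x + - 1#) * 1# + 1#                            ≈⟨ +-congʳ (*-congˡ w[x+1]≈1) ⟨
    (x + - 1#) * (w * (x + - (- 1#))) + 1#          ≈⟨ solve 2 (λ x w → (x :- con 1ℚ) :* (w :* (x :- (:- con 1ℚ))) :+ con 1ℚ := w :* (x :* x :- con 1ℚ) :+ con 1ℚ) refl x w ⟩
    w * (x * x + - 1#) + 1#                         ≈⟨ +-congʳ (*-congˡ (+-congʳ xx≈1)) ⟩
    w * (1# + - 1#) + 1#                            ≈⟨ solve 1 (λ w → w :* (con 1ℚ :- con 1ℚ) :+ con 1ℚ := con 1ℚ) refl w ⟩
    1#                                              ≈⟨ ι-1 ⟨
    ι 1ℚ                                            ∎)
    where open Solver

-- Evaluation at an element, and minimality of an irreducible polynomial.

module Evaluation {c ℓ₁ ℓ₂ : Level} (K : ExtensionOfℚ c ℓ₁ ℓ₂) (t : ExtensionOfℚ.Carrier K) where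
  open ExtensionProperties K
  open ℚ[X]
  open Solver using (solve; _:=_; _:+_; _:*_; con)
  open ≈-Reasoning setoid

  eval : Poly → Carrier
  eval []      = 0#
  eval (a ∷ p) = ι a + t * eval p

  eval-≈0 : ∀ p → p ≈ₚ [] → eval p ≈ 0#
  eval-≈0 []      p≈0 = refl
  eval-≈0 (a ∷ p) p≈0 = begin
    ι a + t * eval p  ≈⟨ +-cong (trans (ι-cong (p≈0 0)) ι-0) (*-congˡ (eval-≈0 p λ n → p≈0 (suc n))) ⟩
    0# + t * 0#       ≈⟨ solve 1 (λ t → con 0ℚ :+ t :* con 0ℚ := con 0ℚ) refl t ⟩
    0#                ∎

  eval-cong : ∀ p r → p ≈ₚ r → eval p ≈ eval r
  eval-cong []      r       p≈r = sym (eval-≈0 r λ n → ≡.sym (p≈r n))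
  eval-cong (a ∷ p) []      p≈r = eval-≈0 (a ∷ p) p≈r
  eval-cong (a ∷ p) (b ∷ r) p≈r =
    +-cong (ι-cong (p≈r 0)) (*-congˡ (eval-cong p r λ n → p≈r (suc n)))

  eval-+ : ∀ p r → eval (p +ₚ r) ≈ eval p + eval r
  eval-+ []      r       = sym (+-identityˡ (eval r))
  eval-+ (a ∷ p) []      = sym (+-identityʳ (eval (a ∷ p)))
  eval-+ (a ∷ p) (b ∷ r) = begin
    ι (a ℚ.+ b) + t * eval (p +ₚ r)              ≈⟨ +-cong (ι-+ a b) (*-congˡ (eval-+ p r)) ⟩
    (ι a + ι b) + t * (eval p + eval r)          ≈⟨ solve 5 (λ a b t x y → (a :+ b) :+ t :* (x :+ y) := (a :+ t :* x) :+ (b :+ t :* y)) refl (ι a) (ι b) t (eval p) (eval r) ⟩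
    (ι a + t * eval p) + (ι b + t * eval r)      ∎

  eval-scale : ∀ a p → eval (map (a ℚ.*_) p) ≈ ι a * eval p
  eval-scale a []      = sym (zeroʳ (ι a))
  eval-scale a (b ∷ p) = begin
    ι (a ℚ.* b) + t * eval (map (a ℚ.*_) p)  ≈⟨ +-cong (ι-* a b) (*-congˡ (eval-scale a p)) ⟩
    ι a * ι b + t * (ι a * eval p)           ≈⟨ solve 4 (λ a b t x → a :* b :+ t :* (a :* x) := a :* (b :+ t :* x)) refl (ι a) (ι b) t (eval p) ⟩
    ι a * (ι b + t * eval p)                 ∎

  eval-* : ∀ p r → eval (p *ₚ r) ≈ eval p * eval r
  eval-* []      r = sym (zeroˡ (eval r))
  eval-* (a ∷ p) r = begin
    eval (map (a ℚ.*_) r +ₚ (0ℚ ∷ p *ₚ r))                   ≈⟨ eval-+ (map (a ℚ.*_) r) (0ℚ ∷ p *ₚ r) ⟩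
    eval (map (a ℚ.*_) r) + (ι 0ℚ + t * eval (p *ₚ r))       ≈⟨ +-cong (eval-scale a r) (+-cong ι-0 (*-congˡ (eval-* p r))) ⟩
    ι a * eval r + (0# + t * (eval p * eval r))              ≈⟨ solve 4 (λ a t x y → a :* y :+ (con 0ℚ :+ t :* (x :* y)) := (a :+ t :* x) :* y) refl (ι a) t (eval p) (eval r) ⟩
    (ι a + t * eval p) * eval r                              ∎

  eval-const : ∀ a → eval (const a) ≈ ι a
  eval-const a = trans (+-congˡ (zeroʳ t)) (+-identityʳ (ι a))

  root⇒∤1 : ∀ p → eval p ≈ 0# → ¬ p ∣ const 1ℚ
  root⇒∤1 p p[t]≈0 (w , wp≈1) = 1≉0 (begin
    1#                   ≈⟨ trans (eval-const 1ℚ) ι-1 ⟨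
    eval (const 1ℚ)      ≈⟨ eval-cong (w *ₚ p) (const 1ℚ) wp≈1 ⟨
    eval (w *ₚ p)        ≈⟨ trans (eval-* w p) (*-congˡ p[t]≈0) ⟩
    eval w * 0#          ≈⟨ zeroʳ (eval w) ⟩
    0#                   ∎)

  module _ {f : Poly} {d : ℕ} (f-irreducible : IrreducibleOverℚ f) (f-deg : HasDegree f d)
           (f[t]≈0 : eval f ≈ 0#) where
    open SemiringDefs.Irreducible f-irreducible

    -- Irreducibility makes `s` or `p` a unit. A unit `s` is constant, which leaves the product with
    -- degree below `d`; a unit `p` cannot vanish at `t`.
    no-proper-factor : ∀ s p → DegreeBelow d p → eval p ≈ 0# → ¬ f ≈ₚ s *ₚ p
    no-proper-factor s p p-deg p[t]≈0 f≈sp with split-∣1 f≈sp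
    ... | inj₁ s∣1 = leading≢0 f-deg
      (≡.trans (f≈sp d) (*-constant-degree s p (∣1⇒constant s s∣1) p-deg d ℕ.≤-refl))
    ... | inj₂ p∣1 = root⇒∤1 p p[t]≈0 p∣1

    -- Induction on the degree bound. If `p` is nonzero, the remainder of `f` modulo `p` also
    -- vanishes at `t` and has smaller degree, so it is zero by induction. Then `p` is a factor of
    -- `f`, which `no-proper-factor` excludes.
    irreducible⇒minimal : ∀ n → n ℕ.≤ d → ∀ p → DegreeBelow n p → eval p ≈ 0# → p ≈ₚ []
    irreducible⇒minimal zero    n≤d p p-deg p[t]≈0 = λ n → p-deg n z≤n
    irreducible⇒minimal (suc n) n<d p p-deg p[t]≈0 with degree p
    ... | inj₁ p≈0 = p≈0
    ... | inj₂ (k , k-deg) with k ℕ.≤? n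
    ...   | no  k≰n = contradiction (p-deg k (ℕ.≰⇒> k≰n)) (leading≢0 k-deg)
    ...   | yes k≤n with divide f k-deg
    ...     | s , r , f≈sp+r , r-deg = contradiction f≈sp
      (no-proper-factor s p (λ i d≤i → p-deg i (ℕ.≤-trans n<d d≤i)) p[t]≈0)
      where
      r[t]≈0 : eval r ≈ 0#
      r[t]≈0 = begin
        eval r                       ≈⟨ +-identityˡ (eval r) ⟨
        0# + eval r                  ≈⟨ +-congʳ (trans (*-congˡ p[t]≈0) (zeroʳ (eval s))) ⟨
        eval s * eval p + eval r     ≈⟨ +-congʳ (eval-* s p) ⟨
        eval (s *ₚ p) + eval r       ≈⟨ eval-+ (s *ₚ p) r ⟨
        eval (s *ₚ p +ₚ r)           ≈⟨ eval-cong f (s *ₚ p +ₚ r) f≈sp+r ⟨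
        eval f                       ≈⟨ f[t]≈0 ⟩
        0#                           ∎
      r≈0 : r ≈ₚ []
      r≈0 = irreducible⇒minimal n (ℕ.<⇒≤ n<d) r (λ i n≤i → r-deg i (ℕ.≤-trans k≤n n≤i)) r[t]≈0
      f≈sp : f ≈ₚ s *ₚ p
      f≈sp i = ≡.trans (f≈sp+r i) (≡.trans (coeff-+ (s *ₚ p) r i)
        (≡.trans (≡.cong (coeff (s *ₚ p) i ℚ.+_) (r≈0 i)) (ℚ.+-identityʳ (coeff (s *ₚ p) i))))

-- The cubic obtained by squaring a linear relation.

module Resolvent {c ℓ₁ ℓ₂ : Level} (K : ExtensionOfℚ c ℓ₁ ℓ₂) (A e : ℚ)
                 (t : ExtensionOfℚ.Carrier K) where
  open ExtensionProperties K
  open Evaluation K t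
  open ≈-Reasoning setoid
  open Solver using (solve; _:=_; _:+_; _:*_; _:-_; :-_; con)

  -- The cubic t (x + y t)² − 2 e z w − w² t (A − t²).
  resolvent : ℚ → ℚ → ℚ → ℚ → ℚ[X].Poly
  resolvent x y z w =
    ℚ.- (e ℚ.* (z ℚ.* w) ℚ.+ e ℚ.* (z ℚ.* w))
    ∷ x ℚ.* x ℚ.+ ℚ.- (w ℚ.* w ℚ.* A)
    ∷ x ℚ.* y ℚ.+ x ℚ.* y
    ∷ y ℚ.* y ℚ.+ w ℚ.* w
    ∷ []

  module _ {u v : Carrier} (tuv≈e : t * u * v ≈ ι e) (t²+u²+v²≈A : t * t + u * u + v * v ≈ ι A) where

    -- The right side keeps the nested shape of `eval`, with `e` and `A` replaced by their
    -- expressions in the roots. What remains to prove is then a polynomial identity in seven free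
    -- variables.
    eval-resolvent : ∀ x y z w →
      eval (resolvent x y z w) ≈
        - (t * u * v * (ι z * ι w) + t * u * v * (ι z * ι w))
        + t * (ι x * ι x + - (ι w * ι w * (t * t + u * u + v * v))
        + t * (ι x * ι y + ι x * ι y
        + t * (ι y * ι y + ι w * ι w + t * 0#)))
    eval-resolvent x y z w =
      +-cong (trans (ι-neg _) (-‿cong (trans (ι-+ _ _) (+-cong ezw ezw)))) (*-congˡ
      (+-cong (trans (ι-+ _ _) (+-cong (ι-* x x) (trans (ι-neg _) (-‿cong wwA)))) (*-congˡ
      (+-cong (trans (ι-+ _ _) (+-cong (ι-* x y) (ι-* x y))) (*-congˡ
      (+-congʳ (trans (ι-+ _ _) (+-cong (ι-* y y) (ι-* w w)))))))))
      where
      ezw : ι (e ℚ.* (z ℚ.* w)) ≈ t * u * v * (ι z * ι w)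
      ezw = trans (ι-* e (z ℚ.* w)) (*-cong (sym tuv≈e) (ι-* z w))
      wwA : ι (w ℚ.* w ℚ.* A) ≈ ι w * ι w * (t * t + u * u + v * v)
      wwA = trans (ι-* _ A) (*-cong (ι-* w w) (sym t²+u²+v²≈A))

    -- The two sides differ by the relation times t (x + y t - z u - w v), that is, by t ((x + y t)²
    -- - (z u + w v)²).
    relation⇒eval-resolvent : ∀ x y z w → ι x + ι y * t + ι z * u + ι w * v ≈ 0# →
      eval (resolvent x y z w) ≈ t * (ι z * ι z + - (ι w * ι w)) * (u * u)
    relation⇒eval-resolvent x y z w relation = begin
      eval (resolvent x y z w)
        ≈⟨ eval-resolvent x y z w ⟩
      _
        ≈⟨ solve 7 (λ x y z w t u v →
             :- (t :* u :* v :* (z :* w) :+ t :* u :* v :* (z :* w))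
             :+ t :* (x :* x :+ :- (w :* w :* (t :* t :+ u :* u :+ v :* v))
             :+ t :* (x :* y :+ x :* y
             :+ t :* (y :* y :+ w :* w :+ t :* con 0ℚ)))
             := t :* (z :* z :+ :- (w :* w)) :* (u :* u)
                :+ (x :+ y :* t :+ z :* u :+ w :* v) :* (t :* (x :+ y :* t :- z :* u :- w :* v)))
             refl (ι x) (ι y) (ι z) (ι w) t u v ⟩
      value + (ι x + ι y * t + ι z * u + ι w * v) * conjugate
        ≈⟨ +-congˡ (trans (*-congʳ relation) (zeroˡ conjugate)) ⟩
      value + 0#
        ≈⟨ +-identityʳ value ⟩
      value ∎
      where
      value     = t * (ι z * ι z + - (ι w * ι w)) * (u * u)
      conjugate = t * (ι x + ι y * t + - (ι z * u) + - (ι w * v))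

-- The roots of q and their linear independence.

module Roots {c ℓ₁ ℓ₂ : Level} (K : ExtensionOfℚ c ℓ₁ ℓ₂) (l m : ℕ)
             (t u v : ExtensionOfℚ.Carrier K) where
  open ExtensionProperties K
  open Evaluation K t
  open ℚ[X] using (Poly; coeff; _≈ₚ_; _+ₚ_; _*ₚ_; const)
  open ≈-Reasoning setoid
  open Solver using (Polynomial; solve; _:=_; _:+_; _:*_; _:-_; :-_; con)
  open +-*-Solver using ()
    renaming (solve to ℚ-solve; _:=_ to infix 4 _⊜_; _:+_ to infixl 7 _⊕_; _:*_ to infixl 8 _⊛_; :-_ to infix 9 ⊝_; con to #)

  A : ℚ
  A = fromℕ (l ℕ.+ m ℕ.+ 3)

  roots : List Carrier
  roots = t ∷ - t ∷ u ∷ - u ∷ v ∷ - v ∷ []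

  module KX = Defs.Polynomial rawRing
  module EX n = Defs.Polynomial (exprRing n)

  split : Carrier → KX.Poly
  split a = KX.const a KX.*ₚ KX.∏[X- roots ]

  :split : ∀ {n} (a t u v : Polynomial n) → EX.Poly n
  :split {n} a t u v = EX._*ₚ_ n (EX.const n a) (EX.∏[X-_] n (t ∷ :- t ∷ u ∷ :- u ∷ v ∷ :- v ∷ []))

  module _ (has-roots : HasRoots K (q l m) roots) where

    private
      a = proj₁ has-roots
      q≈split = proj₂ (proj₂ has-roots)

    -- `HasRoots` permits any scalar apart from 0; the coefficient of degree 6 fixes it, as q is
    -- monic.
    a≈1 : a ≈ 1#
    a≈1 = begin
      a                        ≈⟨ solve 4 (λ a t u v → EX.coeff 4 (:split a t u v) 6 := a) refl a t u v ⟨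
      KX.coeff (split a) 6     ≈⟨ q≈split 6 ⟨
      ι 1ℚ                     ≈⟨ ι-1 ⟩
      1#                       ∎

    -- The split form is a (X² - t²)(X² - u²)(X² - v²), with constant term -a (tuv)²; that of q is
    -- -1.
    [tuv]²≈1 : (t * u * v) * (t * u * v) ≈ 1#
    [tuv]²≈1 = begin
      (t * u * v) * (t * u * v)         ≈⟨ *-identityˡ _ ⟨
      1# * ((t * u * v) * (t * u * v))  ≈⟨ *-congʳ a≈1 ⟨
      a * ((t * u * v) * (t * u * v))   ≈⟨ solve 4 (λ a t u v → a :* ((t :* u :* v) :* (t :* u :* v)) := :- EX.coeff 4 (:split a t u v) 0) refl a t u v ⟩
      - KX.coeff (split a) 0            ≈⟨ -‿cong (q≈split 0) ⟨
      - ι (ℚ.- 1ℚ)                      ≈⟨ solve 0 (:- con (ℚ.- 1ℚ) := con 1ℚ) refl ⟩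
      1#                                ∎

    t²+u²+v²≈A : t * t + u * u + v * v ≈ ι A
    t²+u²+v²≈A = begin
      t * t + u * u + v * v        ≈⟨ *-identityˡ _ ⟨
      1# * (t * t + u * u + v * v) ≈⟨ *-congʳ a≈1 ⟨
      a * (t * t + u * u + v * v)  ≈⟨ solve 4 (λ a t u v → a :* (t :* t :+ u :* u :+ v :* v) := :- EX.coeff 4 (:split a t u v) 4) refl a t u v ⟩
      - KX.coeff (split a) 4       ≈⟨ -‿cong (q≈split 4) ⟨
      - ι (ℚ.- A)                  ≈⟨ -‿cong (ι-neg A) ⟩
      - (- ι A)                    ≈⟨ solve 1 (λ x → :- (:- x) := x) refl (ι A) ⟩
      ι A                          ∎

    q[t]≈0 : eval (q l m) ≈ 0#
    q[t]≈0 = trans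
      (+-cong (q≈split 0) (*-congˡ
      (+-cong (q≈split 1) (*-congˡ
      (+-cong (q≈split 2) (*-congˡ
      (+-cong (q≈split 3) (*-congˡ
      (+-cong (q≈split 4) (*-congˡ
      (+-cong (q≈split 5) (*-congˡ
      (+-congʳ (q≈split 6))))))))))))))
      (solve 4 (λ a t u v → let x n = EX.coeff 4 (:split a t u v) n in
        x 0 :+ t :* (x 1 :+ t :* (x 2 :+ t :* (x 3 :+ t :* (x 4 :+ t :* (x 5 :+ t :* (x 6 :+ t :* con 0ℚ))))))
        := con 0ℚ) refl a t u v)

    module _ (q-irreducible : IrreducibleOverℚ (q l m)) where

      minimal : ∀ p → DegreeBelow 6 p → eval p ≈ 0# → p ≈ₚ []
      minimal = irreducible⇒minimal q-irreducible (q-degree l m) q[t]≈0 6 ℕ.≤-refl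

      -- Subtracting `k` times q removes the term of degree 6, so by minimality the difference is
      -- zero. Since q has constant term -1, its constant coefficient is `coeff p 0` + `k`.
      sextic-ends : ∀ p → DegreeBelow 7 p → eval p ≈ 0# → coeff p 0 ℚ.+ coeff p 6 ≡ 0ℚ
      sextic-ends p p-deg p[t]≈0 =
        ≡.trans (ℚ-solve 2 (λ x k → x ⊕ k ⊜ x ⊕ (⊝ k) ⊛ (⊝ # 1ℚ)) ≡.refl (coeff p 0) k)
          (≡.trans (≡.sym (coeff-r 0)) (minimal r r-deg r[t]≈0 0))
        where
        k = coeff p 6
        r = p +ₚ map ((ℚ.- k) ℚ.*_) (q l m)

        coeff-r : ∀ n → coeff r n ≡ coeff p n ℚ.+ (ℚ.- k) ℚ.* coeff (q l m) n
        coeff-r n = ≡.trans (coeff-+ p (map ((ℚ.- k) ℚ.*_) (q l m)) n)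
          (≡.cong (coeff p n ℚ.+_) (coeff-scale (ℚ.- k) (q l m) n))

        r-deg : DegreeBelow 6 r
        r-deg n 6≤n with ℕ.m≤n⇒m<n∨m≡n 6≤n
        ... | inj₂ ≡.refl = ≡.trans (coeff-r 6) (ℚ-solve 1 (λ k → k ⊕ (⊝ k) ⊛ # 1ℚ ⊜ # 0ℚ) ≡.refl k)
        ... | inj₁ 6<n = ≡.trans (coeff-r n)
          (≡.trans (≡.cong₂ (λ x y → x ℚ.+ (ℚ.- k) ℚ.* y) (p-deg n 6<n) (above≡0 (q-degree l m) n 6<n))
            (ℚ-solve 1 (λ k → # 0ℚ ⊕ (⊝ k) ⊛ # 0ℚ ⊜ # 0ℚ) ≡.refl k))

        r[t]≈0 : eval r ≈ 0#
        r[t]≈0 = begin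
          eval r                                            ≈⟨ eval-+ p (map ((ℚ.- k) ℚ.*_) (q l m)) ⟩
          eval p + eval (map ((ℚ.- k) ℚ.*_) (q l m))        ≈⟨ +-cong p[t]≈0 (eval-scale (ℚ.- k) (q l m)) ⟩
          0# + ι (ℚ.- k) * eval (q l m)                     ≈⟨ +-identityˡ _ ⟩
          ι (ℚ.- k) * eval (q l m)                          ≈⟨ *-congˡ q[t]≈0 ⟩
          ι (ℚ.- k) * 0#                                    ≈⟨ zeroʳ _ ⟩
          0#                                                ∎

      relation⇒z≡w≡0 : ∀ {e} → e ℚ.* e ≡ 1ℚ → t * u * v ≈ ι e → ∀ x y z w →
        ι x + ι y * t + ι z * u + ι w * v ≈ 0# → z ≡ 0ℚ × w ≡ 0ℚ
      relation⇒z≡w≡0 {e} ee≡1 tuv≈e x y z w relation = norm-positive-definite z w y norm≡0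
        where
        open Resolvent K A e t
        D = z ℚ.* z ℚ.+ ℚ.- (w ℚ.* w)
        f g p : Poly
        f = resolvent x y z w
        -- Exchanging u with v and z with w preserves the relation, the product of the roots and the
        -- sum of their squares, so `g` takes the mirrored value at `t`.
        g = resolvent x y w z
        p = f *ₚ g +ₚ const (D ℚ.* D)

        f[t] : eval f ≈ t * (ι z * ι z + - (ι w * ι w)) * (u * u)
        f[t] = relation⇒eval-resolvent tuv≈e t²+u²+v²≈A x y z w relation

        g[t] : eval g ≈ t * (ι w * ι w + - (ι z * ι z)) * (v * v)
        g[t] = relation⇒eval-resolvent
          (trans (solve 3 (λ t u v → t :* v :* u := t :* u :* v) refl t u v) tuv≈e)
          (trans (solve 3 (λ t u v → t :+ v :+ u := t :+ u :+ v) refl (t * t) (u * u) (v * v)) t²+u²+v²≈A)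
          x y w z
          (trans (solve 4 (λ x y z w → x :+ y :+ w :+ z := x :+ y :+ z :+ w) refl (ι x) (ι y * t) (ι z * u) (ι w * v)) relation)

        ιD : ι D ≈ ι z * ι z + - (ι w * ι w)
        ιD = trans (ι-+ (z ℚ.* z) (ℚ.- (w ℚ.* w)))
          (+-cong (ι-* z z) (trans (ι-neg (w ℚ.* w)) (-‿cong (ι-* w w))))

        p[t]≈0 : eval p ≈ 0#
        p[t]≈0 = begin
          eval p
            ≈⟨ eval-+ (f *ₚ g) (const (D ℚ.* D)) ⟩
          eval (f *ₚ g) + eval (const (D ℚ.* D))
            ≈⟨ +-cong (trans (eval-* f g) (*-cong f[t] g[t]))
                      (trans (eval-const (D ℚ.* D)) (trans (ι-* D D) (*-cong ιD ιD))) ⟩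
          _
            -- Here `z` and `w` stand for the squares z² and w². The product of the two values is
            -- -(z² - w²)² (tuv)², and (tuv)² is 1.
            ≈⟨ solve 5 (λ z w t u v →
                 t :* (z :+ :- w) :* (u :* u) :* (t :* (w :+ :- z) :* (v :* v)) :+ (z :+ :- w) :* (z :+ :- w)
                 := (z :+ :- w) :* (z :+ :- w) :* (con 1ℚ :- t :* u :* v :* (t :* u :* v)))
                 refl (ι z * ι z) (ι w * ι w) t u v ⟩
          Δ * Δ * (1# + - (t * u * v * (t * u * v)))
            ≈⟨ *-congˡ (trans (+-congˡ (-‿cong [tuv]²≈1)) (-‿inverseʳ 1#)) ⟩
          Δ * Δ * 0#
            ≈⟨ zeroʳ _ ⟩
          0# ∎
          where Δ = ι z * ι z + - (ι w * ι w)

        p-deg : DegreeBelow 7 p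
        p-deg _ (s≤s (s≤s (s≤s (s≤s (s≤s (s≤s (s≤s z≤n))))))) = ≡.refl

        norm≡0 : (z ℚ.* z ℚ.+ w ℚ.* w) ℚ.* (z ℚ.* z ℚ.+ w ℚ.* w) ℚ.+
                 (y ℚ.* y ℚ.+ w ℚ.* w) ℚ.* (y ℚ.* y ℚ.+ z ℚ.* z) ≡ 0ℚ
        norm≡0 = ≡.trans
          -- The constant coefficient of `p` is 4 e² z² w² + (z² - w²)², which is (z² + w²)² only
          -- when e² = 1; the last summand, (1 - e²)(2 z w)², makes up the difference. The bare zero
          -- comes from the shift in `_*ₚ_`.
          (ℚ-solve 4 (λ e y z w →
            (z ⊛ z ⊕ w ⊛ w) ⊛ (z ⊛ z ⊕ w ⊛ w) ⊕ (y ⊛ y ⊕ w ⊛ w) ⊛ (y ⊛ y ⊕ z ⊛ z)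
            ⊜ ((⊝ (e ⊛ (z ⊛ w) ⊕ e ⊛ (z ⊛ w))) ⊛ (⊝ (e ⊛ (w ⊛ z) ⊕ e ⊛ (w ⊛ z))) ⊕ # 0ℚ
                ⊕ (z ⊛ z ⊕ ⊝ (w ⊛ w)) ⊛ (z ⊛ z ⊕ ⊝ (w ⊛ w)))
              ⊕ (y ⊛ y ⊕ w ⊛ w) ⊛ (y ⊛ y ⊕ z ⊛ z)
              ⊕ (# 1ℚ ⊕ ⊝ (e ⊛ e)) ⊛ ((z ⊛ w ⊕ z ⊛ w) ⊛ (z ⊛ w ⊕ z ⊛ w)))
            ≡.refl e y z w)
          (≡.cong₂ ℚ._+_ (sextic-ends p p-deg p[t]≈0)
            (≡.trans (≡.cong (λ n → (1ℚ ℚ.+ ℚ.- n) ℚ.* zw²) ee≡1) (ℚ.*-zeroˡ zw²)))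
          where
          zw² = (z ℚ.* w ℚ.+ z ℚ.* w) ℚ.* (z ℚ.* w ℚ.+ z ℚ.* w)

      relation⇒x≡y≡0 : ∀ x y → ι x + ι y * t ≈ 0# → x ≡ 0ℚ × y ≡ 0ℚ
      relation⇒x≡y≡0 x y relation = p≈0 0 , p≈0 1
        where
        p≈0 : x ∷ y ∷ [] ≈ₚ []
        p≈0 = minimal (x ∷ y ∷ []) (λ { _ (s≤s (s≤s _)) → ≡.refl })
          (trans (solve 3 (λ x y t → x :+ t :* (y :+ t :* con 0ℚ) := x :+ y :* t) refl (ι x) (ι y) t) relation)

      linearlyIndependent :
        LinearlyIndependentOverℚ K (1# Vector.∷ t Vector.∷ u Vector.∷ v Vector.∷ Vector.[])
      linearlyIndependent a sum≈0 = λ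
        { 0F → proj₁ x≡y≡0
        ; 1F → proj₂ x≡y≡0
        ; 2F → proj₁ z≡w≡0
        ; 3F → proj₂ z≡w≡0
        }
        where
        x = a 0F
        y = a 1F
        z = a 2F
        w = a 3F

        relation : ι x + ι y * t + ι z * u + ι w * v ≈ 0#
        relation = trans
          (solve 4 (λ x y z w → x :+ y :+ z :+ w := x :* con 1ℚ :+ (y :+ (z :+ (w :+ con 0ℚ))))
            refl (ι x) (ι y * t) (ι z * u) (ι w * v))
          sum≈0

        z≡w≡0 = let _ , ee≡1 , tuv≈e = square≈1⇒±1 [tuv]²≈1 in
                relation⇒z≡w≡0 ee≡1 tuv≈e x y z w relation

        ι*≈0 : ∀ {b s} → b ≡ 0ℚ → ι b * s ≈ 0#
        ι*≈0 {s = s} b≡0 = trans (*-congʳ (trans (ι-cong b≡0) ι-0)) (zeroˡ s)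

        -- With z = w = 0 the relation is linear in `t` alone, and a linear polynomial is below the
        -- degree of q.
        x≡y≡0 = relation⇒x≡y≡0 x y (begin
          ι x + ι y * t                          ≈⟨ solve 1 (λ s → s := s :+ con 0ℚ :+ con 0ℚ) refl _ ⟩
          ι x + ι y * t + 0# + 0#                ≈⟨ +-cong (+-congˡ (ι*≈0 (proj₁ z≡w≡0))) (ι*≈0 (proj₂ z≡w≡0)) ⟨
          ι x + ι y * t + ι z * u + ι w * v      ≈⟨ relation ⟩
          0#                                     ∎)

theorem2p5 : ∀ {c ℓ₁ ℓ₂ : Level} (l m : ℕ) → NonZero l → NonZero m →
    (K : ExtensionOfℚ c ℓ₁ ℓ₂) → IsSplittingField K (q l m) →
    let open ExtensionOfℚ K in
    (θ₁ θ₂ θ₃ : Carrier) →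
    HasRoots K (q l m) (θ₁ ∷ - θ₁ ∷ θ₂ ∷ - θ₂ ∷ θ₃ ∷ - θ₃ ∷ []) →
    IrreducibleOverℚ (q l m) →
    LinearlyIndependentOverℚ K (1# Vector.∷ θ₁ Vector.∷ θ₂ Vector.∷ θ₃ Vector.∷ Vector.[])
theorem2p5 l m _ _ K _ θ₁ θ₂ θ₃ has-roots q-irreducible =
  Roots.linearlyIndependent K l m θ₁ θ₂ θ₃ has-roots q-irreducible
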